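{- Let $G$ be a finite tree, let $\mathcal{P}$ be the set of all paths in $G$ of length $\mathrm{diam}(G)$, and let $v \in V(G)$ be a starting vertex. Let $\ell = \min\{\mathrm{dist}(u,v) : u \in V(P),\ P \in \mathcal{P}\}$ be the distance from $v$ to the nearest vertex lying on some path of $\mathcal{P}$. Then $$f_d(G,v) = \mathrm{diam}(G)+\ell+1.$$
   Context: The length of a path is its number of edges, $\mathrm{dist}(u,v)$ is the length of a shortest path between $u$ and $v$, and $\mathrm{diam}(G)$ is the maximum distance between two vertices of $G$. Explorer-Director game on a connected graph $G$ with starting vertex $v$: a token is initially at $v$ (so $v$ counts as visited). On each turn the Explorer names a distance $d$ such that at least one vertex of $G$ is at distance exactly $d$ from the token's current position, and then the Director moves the token to a vertex of their choice at distance exactly $d$ from the current position. The Explorer wants to maximize, and the Director to minimize, the number of distinct vertices visited by the token; play continues until the Explorer can no longer force the token onto an unvisited vertex. $f_d(G,v)$ is the number of visited vertices at the end of the game under optimal play by both players; equivalently, it is the largest $k$ such that the Explorer has a (possibly adaptive) strategy guaranteeing, against every play of the Director, that at least $k$ distinct vertices (including $v$) are visited after finitely many turns. -}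

module Defs where

open import Data.Nat using (ℕ; suc; _≤_)
open import Data.Fin using (Fin)
open import Data.Fin.Subset using (Subset; ⁅_⁆; _∪_; ∣_∣)
open import Data.Product using (Σ; ∃; ∃₂; _×_)
open import Data.Vec using (Vec; head; last)
open import Data.Vec.Membership.Propositional using (_∈_)
open import Data.Vec.Relation.Unary.Linked using (Linked)
open import Data.Vec.Relation.Unary.Unique.Propositional using (Unique)
open import Level using (0ℓ)
open import Relation.Binary using (Rel; Decidable; Symmetric; Irreflexive)
open import Relation.Binary.PropositionalEquality using (_≡_)
open import Relation.Nullary using (¬_)

IsMinimum : (ℕ → Set) → ℕ → Set
IsMinimum S m = S m × (∀ k → S k → m ≤ k)

IsMaximum : (ℕ → Set) → ℕ → Set
IsMaximum S m = S m × (∀ k → S k → k ≤ m)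

-- Finite simple graphs.  Adjacency is decidable by definition: for a graph
-- given by finite data this costs nothing.
record Graph (n : ℕ) : Set₁ where
  field
    Adj    : Rel (Fin n) 0ℓ
    adj?   : Decidable Adj
    sym    : Symmetric Adj
    irrefl : Irreflexive _≡_ Adj

module _ {n : ℕ} (G : Graph n) where
  open Graph G

  -- The index d is the number of edges, so there are suc d vertices.
  record Path (d : ℕ) : Set where
    field
      vertices : Vec (Fin n) (suc d)
      linked   : Linked Adj vertices
      unique   : Unique vertices

    source target : Fin n
    source = head vertices
    target = last vertices

  open Path

  PathBetween : Fin n → Fin n → ℕ → Set
  PathBetween u v d = Σ (Path d) λ P → source P ≡ u × target P ≡ v

  Connected : Set
  Connected = ∀ u v → ∃ (PathBetween u v)

  -- A cycle is a path on at least three vertices together with an edge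
  -- joining its two ends.
  Acyclic : Set
  Acyclic = ∀ {d} → 2 ≤ d → (P : Path d) → ¬ Adj (target P) (source P)

  IsTree : Set
  IsTree = Connected × Acyclic

  -- "dist(u,v) = d"
  IsDist : Fin n → Fin n → ℕ → Set
  IsDist u v = IsMinimum (PathBetween u v)

  -- "diam(G) = D"
  IsDiam : ℕ → Set
  IsDiam = IsMaximum λ d → ∃₂ λ u v → IsDist u v d

  -- With D = diam(G), Path D is the set of all diametral paths; the predicate
  -- says that the distance from v to the nearest vertex on one of them is l.
  IsDistToPathsOfLength : ℕ → Fin n → ℕ → Set
  IsDistToPathsOfLength D v =
    IsMinimum λ d → Σ (Path D) λ P → ∃ λ u → u ∈ vertices P × IsDist u v d

  -- ExplorerForces k S u: with the token at u and S the set of vertices visited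
  -- so far, the Explorer has a strategy after which, whatever the Director does,
  -- at least k vertices are visited after finitely many turns.  An element is
  -- the strategy tree, branching over the Director's replies; being inductive
  -- it is well-founded, so every play following it is finite.
  data ExplorerForces (k : ℕ) : Subset n → Fin n → Set where
    stop : ∀ {S u} → k ≤ ∣ S ∣ → ExplorerForces k S u
    name : ∀ {S u} (d : ℕ) → (∃ λ w → IsDist u w d) →
           (∀ w → IsDist u w d → ExplorerForces k (S ∪ ⁅ w ⁆) w) →
           ExplorerForces k S u

  -- "f_d(G,v) = k"
  IsVisitedNumber : Fin n → ℕ → Set
  IsVisitedNumber v = IsMaximum λ k → ExplorerForces k ⁅ v ⁆ v

{-# OPTIONS --safe #-}
module Submission where

-- In a tree the non-backtracking walk from r to x is unique, and
-- dist x y + 2c = dist r x + dist r y, where c is the length of the common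
-- prefix of the walks from r to x and to y.  This gives the four-point condition.
--
-- Director: let a be the vertex nearest to v on diametral paths and P a diametral
-- path through a.  The connected set P ∪ [a,v] has D + l + 1 vertices and
-- contains a farthest vertex from each vertex, so the token can be kept in it.
--
-- Explorer: a vertex farthest from any vertex is an end of a diametral path, and
-- naming D there moves the token to an opposite end.  If, at two opposite ends,
-- every distance 0, …, D to the token is already realised by a visited vertex,
-- then at least D + 1 vertices have been visited.  The remaining l vertices are
-- obtained first: let height x be the least excess of dist x e over dist a e among
-- ends e of diametral paths, so that v has height at least l and height is
-- 1-Lipschitz.  Naming only small distances, the Explorer visits l vertices of
-- positive height; these never replace one of the D + 1 vertices above.

open import Defs
open import Data.Fin as Fin using (Fin)
import Data.Fin.Properties as Fin
open import Data.Fin.Subset using (Subset; ⁅_⁆; _∪_; _∩_; ⊥; ∣_∣; _⊆_; outside; inside)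
  renaming (_∈_ to _∈ₛ_; _∉_ to _∉ₛ_)
open import Data.Fin.Subset.Properties
open import Data.List
  using (List; []; _∷_; _++_; length; head; take; drop; foldr; filter; allFin)
open import Data.List.Extrema.Nat
  using (argmin; f[argmin]≤f[xs]; v≤f[argmin]⁺; argmax; f[xs]≤f[argmax])
open import Data.List.Membership.Propositional using (_∈_)
open import Data.List.Membership.Propositional.Properties
  using (∈-++⁺ˡ; ∈-++⁺ʳ; ∈-++⁻; ∈-filter⁺; ∈-allFin)
open import Data.List.Properties using (length-++; length-take; length-drop)
open import Data.List.Relation.Unary.All as All using (All; []; _∷_)
open import Data.List.Relation.Unary.All.Properties
  using (¬Any⇒All¬; All¬⇒¬Any; all-filter)
open import Data.List.Relation.Unary.AllPairs using ([]; _∷_)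
open import Data.List.Relation.Unary.Any using (here; there)
open import Data.List.Relation.Unary.Unique.Propositional using (Unique)
open import Data.List.Relation.Unary.Unique.Propositional.Properties using (take⁺)
open import Data.Maybe using (just)
open import Data.Maybe.Properties using (just-injective)
open import Data.Nat
open import Data.Nat.Properties
open import Data.Nat.Tactic.RingSolver using (solve-∀)
open import Data.Product using (∃; _×_; _,_; proj₁; proj₂)
open import Data.Sum as Sum using (_⊎_; inj₁; inj₂)
open import Data.Vec using (Vec; []; _∷_; toList; fromList; last; tabulate)
import Data.Vec.Membership.Propositional as Vec
open import Data.Vec.Membership.Propositional.Properties using (∈-toList⁺; ∈-fromList⁺)
open import Data.Vec.Properties
  using (toList∘fromList; length-toList; lookup∘tabulate; []=⇒lookup; lookup⇒[]=)
import Data.Vec.Relation.Unary.All as VecAll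
import Data.Vec.Relation.Unary.All.Properties as VecAll
import Data.Vec.Relation.Unary.AllPairs as VecAllPairs
open import Data.Vec.Relation.Unary.Linked using (Linked; [-]; _∷_)
import Data.Vec.Relation.Unary.Unique.Propositional as VecUnique
open import Function using (_∘_; id)
open import Relation.Binary.PropositionalEquality
open import Relation.Nullary
open import Relation.Nullary.Decidable using (decidable-stable; dec-true; _×-dec_; ¬?)
open import Relation.Nullary.Reflects using (invert)
open import Relation.Unary using (Decidable)

-- Common prefixes of lists.

module _ {n : ℕ} where

  lcp : List (Fin n) → List (Fin n) → ℕ
  lcp []       _        = 0
  lcp (_ ∷ _)  []       = 0
  lcp (x ∷ xs) (y ∷ ys) with x Fin.≟ y
  ... | yes _ = suc (lcp xs ys)
  ... | no  _ = 0

  lcp-≤ˡ : ∀ xs ys → lcp xs ys ≤ length xs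
  lcp-≤ˡ []       _        = z≤n
  lcp-≤ˡ (_ ∷ _)  []       = z≤n
  lcp-≤ˡ (x ∷ xs) (y ∷ ys) with x Fin.≟ y
  ... | yes _ = s≤s (lcp-≤ˡ xs ys)
  ... | no  _ = z≤n

  lcp-≤ʳ : ∀ xs ys → lcp xs ys ≤ length ys
  lcp-≤ʳ []       _        = z≤n
  lcp-≤ʳ (_ ∷ _)  []       = z≤n
  lcp-≤ʳ (x ∷ xs) (y ∷ ys) with x Fin.≟ y
  ... | yes _ = s≤s (lcp-≤ʳ xs ys)
  ... | no  _ = z≤n

  -- A prefix that `zs` shares with both `xs` and `ys` is shared by `xs` and `ys`, so the smaller of
  -- those two lengths is a lower bound.
  lcp-ultrametric : ∀ xs ys zs → lcp xs zs ≤ lcp xs ys ⊎ lcp zs ys ≤ lcp xs ys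
  lcp-ultrametric []       _        _        = inj₁ z≤n
  lcp-ultrametric (_ ∷ _)  _        []       = inj₁ z≤n
  lcp-ultrametric (_ ∷ _)  []       (_ ∷ _)  = inj₂ z≤n
  lcp-ultrametric (x ∷ xs) (y ∷ ys) (z ∷ zs) with x Fin.≟ z | x Fin.≟ y | z Fin.≟ y
  ... | no  _   | _       | _       = inj₁ z≤n
  ... | yes _   | _       | no  _   = inj₂ z≤n
  ... | yes x≡z | no  x≢y | yes z≡y = contradiction (trans x≡z z≡y) x≢y
  ... | yes _   | yes _   | yes _   with lcp-ultrametric xs ys zs
  ...   | inj₁ le = inj₁ (s≤s le)
  ...   | inj₂ le = inj₂ (s≤s le)

-- Non-backtracking walks, in general and in acyclic graphs.

module Walks {n : ℕ} (G : Graph n) where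
  open Graph G renaming (sym to adj-sym)
  open Path

  -- NonBacktracking u xs v: the walk u ∷ xs ends at v and never returns along
  -- the edge it has just used.
  data NonBacktracking : Fin n → List (Fin n) → Fin n → Set where
    nil  : ∀ {u} → NonBacktracking u [] u
    cons : ∀ {u w v xs} → Adj u w → NonBacktracking w xs v → head xs ≢ just u →
           NonBacktracking u (w ∷ xs) v

  end∈ : ∀ {u xs v} → NonBacktracking u xs v → v ∈ u ∷ xs
  end∈ nil          = here refl
  end∈ (cons _ p _) = there (end∈ p)

  head-take : ∀ i (xs : List (Fin n)) {w} → head xs ≢ just w → head (take i xs) ≢ just w
  head-take zero    _        _ ()
  head-take (suc i) []       h = h
  head-take (suc i) (x ∷ xs) h = h

  split-at : ∀ {u xs v} i → NonBacktracking u xs v → i ≤ length xs →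
             ∃ λ w → w ∈ u ∷ xs × NonBacktracking u (take i xs) w × NonBacktracking w (drop i xs) v
  split-at zero    p            _        = _ , here refl , nil , p
  split-at (suc i) (cons {xs = xs} a p h) (s≤s i≤) =
    let w , w∈ , p₁ , p₂ = split-at i p i≤
    in  w , there w∈ , cons a p₁ (head-take i xs h) , p₂

  split-∈ : ∀ {u xs v w} → NonBacktracking u xs v → w ∈ u ∷ xs →
            ∃ λ i → i ≤ length xs × NonBacktracking u (take i xs) w × NonBacktracking w (drop i xs) v
  split-∈ p                     (here refl) = 0 , z≤n , nil , p
  split-∈ (cons {xs = xs} a p h) (there w∈) =
    let i , i≤ , p₁ , p₂ = split-∈ p w∈
    in  suc i , s≤s i≤ , cons a p₁ (head-take i xs h) , p₂

  -- The first walk is reversed edge by edge onto the second. `differ` forbids backtracking at the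
  -- current start; after each step it holds again because the first walk does not backtrack.
  join : ∀ {a x y xs ys} → NonBacktracking a xs x → NonBacktracking a ys y →
         (∀ {w} → head xs ≡ just w → head ys ≢ just w) →
         ∃ λ zs → NonBacktracking x zs y × length zs ≡ length xs + length ys
  join nil          q _ = _ , q , refl
  join (cons a p h) q differ =
    let zs , r , len = join p (cons (adj-sym a) q (differ refl)) (λ { hw refl → h hw })
    in  zs , r , trans len (+-suc _ _)

  -- The walks are followed to where they diverge and joined there.
  diverge : ∀ {a x y xs ys} → NonBacktracking a xs x → NonBacktracking a ys y →
            ∃ λ zs → NonBacktracking x zs y × length zs + 2 * lcp xs ys ≡ length xs + length ys
  diverge nil q = let zs , r , len = join nil q (λ ()) in zs , r , trans (+-identityʳ _) len
  diverge p@(cons _ _ _) nil =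
    let zs , r , len = join p nil (λ _ ()) in zs , r , trans (+-identityʳ _) len
  diverge {xs = x ∷ xs} {ys = y ∷ ys} p@(cons a p′ _) q@(cons b q′ _) with x Fin.≟ y
  ... | yes refl =
    let zs , r , len = diverge p′ q′
    in  zs , r , (begin
      length zs + 2 * suc (lcp xs ys)    ≡⟨ shift (length zs) (lcp xs ys) ⟩
      2 + (length zs + 2 * lcp xs ys)    ≡⟨ cong (2 +_) len ⟩
      suc (suc (length xs + length ys))  ≡⟨ cong suc (+-suc (length xs) (length ys)) ⟨
      suc (length xs + suc (length ys))  ∎)
    where
    open ≡-Reasoning
    shift : ∀ l c → l + 2 * suc c ≡ 2 + (l + 2 * c)
    shift = solve-∀
  ... | no x≢y =
    let zs , r , len = join p q (λ { refl refl → x≢y refl })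
    in  zs , r , trans (+-identityʳ _) len

  fromVec : ∀ {k} x (xs : Vec (Fin n) k) → Linked Adj (x ∷ xs) → VecUnique.Unique (x ∷ xs) →
            NonBacktracking x (toList xs) (last (x ∷ xs))
  fromVec x []       _       _ = nil
  fromVec x (w ∷ xs) (a ∷ l) (x≢ VecAllPairs.∷ u) = cons a (fromVec w xs l u) (fresh xs x≢)
    where
    fresh : ∀ {k w} (xs : Vec (Fin n) k) → VecAll.All (x ≢_) (w ∷ xs) → head (toList xs) ≢ just x
    fresh (y ∷ _) (_ VecAll.∷ x≢y VecAll.∷ _) = x≢y ∘ sym ∘ just-injective

  uniqueVec : {xs : List (Fin n)} → Unique xs → VecUnique.Unique (fromList xs)
  uniqueVec []       = VecAllPairs.[]
  uniqueVec {x ∷ xs} (x≢ ∷ u) =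
    VecAll.toList⁻ (subst (All (x ≢_)) (sym (toList∘fromList xs)) x≢) VecAllPairs.∷ uniqueVec u

  linkedVec : ∀ {u xs v} → NonBacktracking u xs v → Linked Adj (u ∷ fromList xs)
  linkedVec nil          = [-]
  linkedVec (cons a p _) = a ∷ linkedVec p

  lastVec : ∀ {u xs v} → NonBacktracking u xs v → last (u ∷ fromList xs) ≡ v
  lastVec nil          = refl
  lastVec (cons a p _) = lastVec p

  toPath : ∀ {u xs v} → NonBacktracking u xs v → Unique (u ∷ xs) → Path G (length xs)
  toPath {u} {xs} p uniq = record
    { vertices = u ∷ fromList xs ; linked = linkedVec p ; unique = uniqueVec uniq }

  fromPath : ∀ {k} (P : Path G k) →
             ∃ λ xs → NonBacktracking (source P) xs (target P) × length xs ≡ k ×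
                      toList (vertices P) ≡ source P ∷ xs
  fromPath record { vertices = x ∷ xs ; linked = l ; unique = u } =
    toList xs , fromVec x xs l u , length-toList xs , refl

  module _ (acyclic : Acyclic G) where

    -- The edge would close the walk into a cycle. Walks too short for a cycle are excluded by
    -- irreflexivity and by the condition on `head xs`.
    no-shortcut : ∀ {u w xs} → NonBacktracking w xs u → Unique (w ∷ xs) → head xs ≢ just u → ¬ Adj u w
    no-shortcut nil                     _    _ a = irrefl refl a
    no-shortcut (cons _ nil _)          _    h a = h refl
    no-shortcut q@(cons _ (cons _ _ _) _) uniq _ a =
      acyclic (s≤s (s≤s z≤n)) (toPath q uniq) (subst (λ t → Adj t _) (sym (lastVec q)) a)

    -- If the start recurred, the walk up to its recurrence, with distinct vertices by induction,
    -- would be closed by the first edge.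
    unique-vertices : ∀ {u xs v} → NonBacktracking u xs v → Unique (u ∷ xs)
    unique-vertices nil = [] ∷ []
    unique-vertices {u} (cons {w = w} {xs = xs} a p h) = ¬Any⇒All¬ _ u∉ ∷ unique-vertices p
      where
      u∉ : ¬ u ∈ w ∷ xs
      u∉ u∈ =
        let i , _ , q , _ = split-∈ p u∈
        in  no-shortcut q (take⁺ (suc i) (unique-vertices p)) (head-take i xs h) a

    closed⇒trivial : ∀ {u xs} → NonBacktracking u xs u → xs ≡ []
    closed⇒trivial nil = refl
    closed⇒trivial p@(cons _ p′ _) with unique-vertices p
    ... | u∉ ∷ _ = contradiction (end∈ p′) (All¬⇒¬Any u∉)

    -- Joining the two walks where they diverge gives a closed walk, which is trivial. Hence twice
    -- the common prefix has the total length of both, and the prefix is no longer than either.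
    length-unique : ∀ {u v xs ys} → NonBacktracking u xs v → NonBacktracking u ys v → length xs ≡ length ys
    length-unique {xs = xs} {ys} p q with diverge p q
    ... | zs , r , len with closed⇒trivial r
    ... | refl = ≤-antisym
      (+-cancelʳ-≤ (length ys) _ _ (begin
        length xs + length ys  ≡⟨ len ⟨
        2 * lcp xs ys          ≤⟨ *-monoʳ-≤ 2 (lcp-≤ʳ xs ys) ⟩
        2 * length ys          ≡⟨ cong (length ys +_) (+-identityʳ _) ⟩
        length ys + length ys  ∎))
      (+-cancelˡ-≤ (length xs) _ _ (begin
        length xs + length ys  ≡⟨ len ⟨
        2 * lcp xs ys          ≤⟨ *-monoʳ-≤ 2 (lcp-≤ˡ xs ys) ⟩
        2 * length xs          ≡⟨ cong (length xs +_) (+-identityʳ _) ⟩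
        length xs + length xs  ∎))
      where open ≤-Reasoning

-- The metric of a tree.

module Trees {n : ℕ} (G : Graph n) (tree : IsTree G) where
  open Graph G renaming (sym to adj-sym)
  open Walks G
  open Path

  -- The length of whichever path connectedness supplies; by `length-unique` the choice does not
  -- matter.
  dist : Fin n → Fin n → ℕ
  dist u v = proj₁ (proj₁ tree u v)

  PathBetween⇒walk : ∀ {u v k} → PathBetween G u v k → ∃ λ xs → NonBacktracking u xs v × length xs ≡ k
  PathBetween⇒walk (P , refl , refl) = let xs , p , len , _ = fromPath P in xs , p , len

  route : Fin n → Fin n → List (Fin n)
  route u v = proj₁ (PathBetween⇒walk (proj₂ (proj₁ tree u v)))

  route-walk : ∀ u v → NonBacktracking u (route u v) v
  route-walk u v = proj₁ (proj₂ (PathBetween⇒walk (proj₂ (proj₁ tree u v))))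

  length-route : ∀ u v → length (route u v) ≡ dist u v
  length-route u v = proj₂ (proj₂ (PathBetween⇒walk (proj₂ (proj₁ tree u v))))

  length≡dist : ∀ {u v xs} → NonBacktracking u xs v → length xs ≡ dist u v
  length≡dist p = trans (length-unique (proj₂ tree) p (route-walk _ _)) (length-route _ _)

  PathBetween⇒dist : ∀ {u v k} → PathBetween G u v k → dist u v ≡ k
  PathBetween⇒dist P = let _ , p , len = PathBetween⇒walk P in trans (sym (length≡dist p)) len

  dist-IsDist : ∀ u v → IsDist G u v (dist u v)
  dist-IsDist u v = proj₂ (proj₁ tree u v) , λ k P → ≤-reflexive (PathBetween⇒dist P)

  IsDist⇒dist : ∀ {u v k} → IsDist G u v k → dist u v ≡ k
  IsDist⇒dist = PathBetween⇒dist ∘ proj₁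

  dist⇒IsDist : ∀ {u v k} → dist u v ≡ k → IsDist G u v k
  dist⇒IsDist refl = dist-IsDist _ _

  dist-refl : ∀ u → dist u u ≡ 0
  dist-refl u = sym (length≡dist nil)

  dist-sym : ∀ u v → dist u v ≡ dist v u
  dist-sym u v =
    let _ , r , len = join (route-walk u v) nil (λ _ ())
    in  trans (sym (length-route u v)) (trans (sym (trans len (+-identityʳ _))) (length≡dist r))

  dist-adj : ∀ {u w} → Adj u w → dist u w ≡ 1
  dist-adj a = sym (length≡dist (cons a nil λ ()))

  -- The Gromov product of `x` and `y` with base point `r`.
  gromov : Fin n → Fin n → Fin n → ℕ
  gromov r x y = lcp (route r x) (route r y)

  dist-gromov : ∀ r x y → dist x y + 2 * gromov r x y ≡ dist r x + dist r y
  dist-gromov r x y =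
    let zs , p , len = diverge (route-walk r x) (route-walk r y)
    in  trans (cong (_+ 2 * gromov r x y) (sym (length≡dist p)))
              (trans len (cong₂ _+_ (length-route r x) (length-route r y)))

  dist-triangle : ∀ x r y → dist x y ≤ dist x r + dist r y
  dist-triangle x r y = begin
    dist x y                       ≤⟨ m≤m+n _ _ ⟩
    dist x y + 2 * gromov r x y    ≡⟨ dist-gromov r x y ⟩
    dist r x + dist r y            ≡⟨ cong (_+ dist r y) (dist-sym r x) ⟩
    dist x r + dist r y            ∎
    where open ≤-Reasoning

  between : ∀ {u xs v w} → NonBacktracking u xs v → w ∈ u ∷ xs → dist u w + dist w v ≡ dist u v
  between {u} {xs} {v} {w} p w∈ =
    let i , i≤ , p₁ , p₂ = split-∈ p w∈ in begin
    dist u w + dist w v                        ≡⟨ cong₂ _+_ (length≡dist p₁) (length≡dist p₂) ⟨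
    length (take i xs) + length (drop i xs)    ≡⟨ cong₂ _+_ (trans (length-take i xs) (m≤n⇒m⊓n≡m i≤))
                                                            (length-drop i xs) ⟩
    i + (length xs ∸ i)                        ≡⟨ m+[n∸m]≡n i≤ ⟩
    length xs                                  ≡⟨ length≡dist p ⟩
    dist u v                                   ∎
    where open ≡-Reasoning

  geodesic : ∀ u v {i} → i ≤ dist u v → ∃ λ w → w ∈ u ∷ route u v × dist u w ≡ i
  geodesic u v {i} i≤ =
    let w , w∈ , p , _ = split-at i (route-walk u v) i≤′
    in  w , w∈ , trans (sym (length≡dist p)) (trans (length-take i _) (m≤n⇒m⊓n≡m i≤′))
    where
    i≤′ : i ≤ length (route u v)
    i≤′ = ≤-trans i≤ (≤-reflexive (sym (length-route u v)))

  geodesic-path : ∀ {x y k} → dist x y ≡ k →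
                  ∃ λ (P : Path G k) → ∀ {m} → m ∈ x ∷ route x y → m Vec.∈ vertices P
  geodesic-path {x} {y} xy≡k =
    subst (λ k → ∃ λ (P : Path G k) → ∀ {m} → m ∈ x ∷ route x y → m Vec.∈ vertices P)
      (trans (length-route x y) xy≡k)
      (toPath (route-walk x y) (unique-vertices (proj₂ tree) (route-walk x y)) , ∈-fromList⁺)

  -- This is the ultrametric inequality for Gromov products based at `w`, with `dist-gromov` used to
  -- replace products by distances.
  four-point : ∀ w x y z → dist x y + dist w z ≤ dist x z + dist w y ⊎
                           dist x y + dist w z ≤ dist z y + dist w x
  four-point w x y z =
    Sum.map (cancel (dist w x) (dist-gromov w x y) (dist-gromov w x z))
            (cancel (dist w y) (trans (dist-gromov w x y) (+-comm (dist w x) _))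
                               (trans (dist-gromov w z y) (+-comm (dist w z) _)))
            (lcp-ultrametric (route w x) (route w y) (route w z))
    where
    open ≤-Reasoning
    cancel : ∀ s {a b g h q r} → a + 2 * g ≡ s + q → b + 2 * h ≡ s + r → h ≤ g → a + r ≤ b + q
    cancel s {a} {b} {g} {h} {q} {r} eq₁ eq₂ h≤g = +-cancelʳ-≤ (2 * g) _ _ (begin
      a + r + 2 * g    ≡⟨ swap a r (2 * g) ⟩
      a + 2 * g + r    ≡⟨ cong (_+ r) eq₁ ⟩
      s + q + r        ≡⟨ swap s q r ⟩
      s + r + q        ≡⟨ cong (_+ q) eq₂ ⟨
      b + 2 * h + q    ≤⟨ +-monoˡ-≤ q (+-monoʳ-≤ b (*-monoʳ-≤ 2 h≤g)) ⟩
      b + 2 * g + q    ≡⟨ swap b (2 * g) q ⟩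
      b + q + 2 * g    ∎)
      where
      swap : ∀ x y z → x + y + z ≡ x + z + y
      swap = solve-∀

  -- m is the projection of v onto the path from x to y.
  median : ∀ v x y → ∃ λ m → m ∈ x ∷ route x y × dist x y + 2 * dist v m ≤ dist v x + dist v y
  median v x y = m , m∈ , +-cancelʳ-≤ (2 * i) _ _ (begin
      dist x y + 2 * dist v m + 2 * i      ≡⟨ double (dist x y) (dist v m) i ⟩
      dist x y + 2 * (dist v m + i)        ≤⟨ +-monoʳ-≤ (dist x y) (*-monoʳ-≤ 2 vm+i≤vx) ⟩
      dist x y + 2 * dist v x              ≡⟨ cong (λ t → dist x y + (t + (dist v x + 0))) (dist-sym v x) ⟩
      dist x y + (dist x v + (dist v x + 0)) ≡⟨ collect (dist x y) (dist x v) (dist v x) ⟩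
      dist v x + (dist x v + dist x y)     ≡⟨ cong (dist v x +_) (dist-gromov x v y) ⟨
      dist v x + (dist v y + 2 * i)        ≡⟨ +-assoc (dist v x) _ _ ⟨
      dist v x + dist v y + 2 * i          ∎)
    where
    open ≤-Reasoning
    -- The routes from `x` to `v` and to `y` part after `i` edges, and `m` is placed there.
    i : ℕ
    i = gromov x v y
    i≤ : i ≤ dist x y
    i≤ = ≤-trans (lcp-≤ʳ (route x v) (route x y)) (≤-reflexive (length-route x y))
    m : Fin n
    m = proj₁ (geodesic x y i≤)
    m∈ : m ∈ x ∷ route x y
    m∈ = proj₁ (proj₂ (geodesic x y i≤))
    xm≡i : dist x m ≡ i
    xm≡i = proj₂ (proj₂ (geodesic x y i≤))
    double : ∀ a b c → a + 2 * b + 2 * c ≡ a + 2 * (b + c)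
    double = solve-∀
    collect : ∀ a b c → a + (b + (c + 0)) ≡ c + (b + a)
    collect = solve-∀
    i+my≡xy : i + dist m y ≡ dist x y
    i+my≡xy = subst (λ t → t + dist m y ≡ dist x y) xm≡i (between (route-walk x y) m∈)
    regroup : ∀ a b c → a + (b + c) ≡ b + (a + c)
    regroup = solve-∀
    vm+i≤vx : dist v m + i ≤ dist v x
    vm+i≤vx with four-point x v m y
    ... | inj₁ le = +-cancelʳ-≤ (dist m y + i) _ _ (begin
      dist v m + i + (dist m y + i)      ≡⟨ f (dist v m) i (dist m y) ⟩
      dist v m + (i + dist m y) + i      ≡⟨ cong (λ t → dist v m + t + i) i+my≡xy ⟩
      dist v m + dist x y + i            ≤⟨ +-monoˡ-≤ i le ⟩
      dist v y + dist x m + i            ≡⟨ cong (λ t → dist v y + t + i) xm≡i ⟩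
      dist v y + i + i                   ≡⟨ g (dist v y) i ⟩
      dist v y + 2 * i                   ≡⟨ dist-gromov x v y ⟩
      dist x v + dist x y                ≡⟨ cong₂ _+_ (dist-sym x v) (trans (sym i+my≡xy) (+-comm i _)) ⟩
      dist v x + (dist m y + i)          ∎)
      where
      f : ∀ a b c → a + b + (c + b) ≡ a + (b + c) + b
      f = solve-∀
      g : ∀ a b → a + b + b ≡ a + 2 * b
      g = solve-∀
    ... | inj₂ le = +-cancelʳ-≤ (dist m y) _ _ (begin
      dist v m + i + dist m y    ≡⟨ +-assoc (dist v m) i _ ⟩
      dist v m + (i + dist m y)  ≡⟨ cong (dist v m +_) i+my≡xy ⟩
      dist v m + dist x y        ≤⟨ le ⟩
      dist y m + dist x v        ≡⟨ cong₂ _+_ (dist-sym y m) (dist-sym x v) ⟩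
      dist m y + dist v x        ≡⟨ +-comm (dist m y) _ ⟩
      dist v x + dist m y        ∎)

  -- Diametral pairs and their ends.

  module _ {p q} (diametral : ∀ x y → dist x y ≤ dist p q) where
    open ≤-Reasoning

    -- In the four-point inequality for `u`, `p`, `q`, `x`, the term `dist p x` or `dist x q` is at
    -- most `dist p q` and cancels against it.
    farther-end : ∀ u x → dist u x ≤ dist u p ⊎ dist u x ≤ dist u q
    farther-end u x with four-point u p q x
    ... | inj₁ le = inj₂ (+-cancelˡ-≤ (dist p q) _ _ (≤-trans le (+-monoˡ-≤ (dist u q) (diametral p x))))
    ... | inj₂ le = inj₁ (+-cancelˡ-≤ (dist p q) _ _ (≤-trans le (+-monoˡ-≤ (dist u p) (diametral x q))))

    -- The same inequality for `x`, `p`, `q`, `e`; now `dist x e` cancels, being at least `dist x p`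
    -- and `dist x q`.
    farthest⇒end : ∀ {x e} → (∀ y → dist x y ≤ dist x e) → ∃ λ y → dist e y ≡ dist p q
    farthest⇒end {x} {e} farthest with four-point x p q e
    ... | inj₁ le = p , ≤-antisym (diametral e p)
      (subst (dist p q ≤_) (dist-sym p e)
        (+-cancelʳ-≤ (dist x e) _ _ (≤-trans le (+-monoʳ-≤ (dist p e) (farthest q)))))
    ... | inj₂ le = q , ≤-antisym (diametral e q)
      (+-cancelʳ-≤ (dist x e) _ _ (≤-trans le (+-monoʳ-≤ (dist e q) (farthest p))))

    module _ {a v}
      (a-between : dist p a + dist a q ≡ dist p q)
      (nearest : ∀ {x y m} → dist x y ≡ dist p q → m ∈ x ∷ route x y → dist v a ≤ dist v m) where

      private
        sum-≥ : ∀ {x y} → dist x y ≡ dist p q → dist p q + 2 * dist v a ≤ dist v x + dist v y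
        sum-≥ {x} {y} xy≡D =
          let m , m∈ , le = median v x y
          in  ≤-trans (+-mono-≤ (≤-reflexive (sym xy≡D)) (*-monoʳ-≤ 2 (nearest xy≡D m∈))) le

        -- Going to `y` through `a` bounds `dist v y` from above, so `sum-≥` puts the rest of the
        -- sum on `dist v x`.
        via : ∀ {x y} → dist x y ≡ dist p q → dist x y ≡ dist a x + dist a y →
              dist v a + dist a x ≤ dist v x
        via {x} {y} xy≡D split = +-cancelʳ-≤ (dist v a + dist a y) _ _ (begin
          dist v a + dist a x + (dist v a + dist a y)  ≡⟨ f (dist v a) (dist a x) (dist a y) ⟩
          dist a x + dist a y + 2 * dist v a           ≡⟨ cong (_+ 2 * dist v a) (trans (sym split) xy≡D) ⟩
          dist p q + 2 * dist v a                      ≤⟨ sum-≥ xy≡D ⟩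
          dist v x + dist v y                          ≤⟨ +-monoʳ-≤ (dist v x) (dist-triangle v a y) ⟩
          dist v x + (dist v a + dist a y)             ∎)
          where
          f : ∀ l b c → l + b + (l + c) ≡ b + c + 2 * l
          f = solve-∀

        -- Carries the bound from an end to an opposite one. In one case of the four-point
        -- inequality it follows by cancellation; in the other, `sum-≥` for the pair `e`, `z`
        -- supplies the missing `2 * dist v a`.
        via-end : ∀ {e z} → dist e z ≡ dist p q → dist v a + dist a z ≤ dist v z →
                  dist v a + dist a e ≤ dist v e
        via-end {e} {z} ez≡D z-via with four-point v a e z
        ... | inj₁ le = +-cancelʳ-≤ (dist a z) _ _ (begin
          dist v a + dist a e + dist a z    ≡⟨ f (dist v a) (dist a e) (dist a z) ⟩
          dist a e + (dist v a + dist a z)  ≤⟨ +-monoʳ-≤ (dist a e) z-via ⟩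
          dist a e + dist v z               ≤⟨ le ⟩
          dist a z + dist v e               ≡⟨ +-comm (dist a z) _ ⟩
          dist v e + dist a z               ∎)
          where
          f : ∀ l b c → l + b + c ≡ b + (l + c)
          f = solve-∀
        ... | inj₂ le = +-cancelʳ-≤ (dist v a + dist a z) _ _ (begin
          dist v a + dist a e + (dist v a + dist a z)  ≤⟨ +-monoʳ-≤ (dist v a + dist a e) z-via ⟩
          dist v a + dist a e + dist v z               ≡⟨ +-assoc (dist v a) _ _ ⟩
          dist v a + (dist a e + dist v z)             ≤⟨ +-monoʳ-≤ (dist v a) le ⟩
          dist v a + (dist z e + dist v a)             ≡⟨ f (dist v a) (dist z e) ⟩
          dist z e + 2 * dist v a                      ≡⟨ cong (_+ 2 * dist v a) (trans (dist-sym z e) ez≡D) ⟩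
          dist p q + 2 * dist v a                      ≤⟨ sum-≥ ez≡D ⟩
          dist v e + dist v z                          ≤⟨ +-monoʳ-≤ (dist v e) (dist-triangle v a z) ⟩
          dist v e + (dist v a + dist a z)             ∎)
          where
          f : ∀ l b → l + (b + l) ≡ b + 2 * l
          f = solve-∀

      -- By `farther-end`, each end is opposite to `p` or `q`, and for these two `via` applies
      -- because `a` lies between them. The Explorer needs this to know that `v` has height at least
      -- `dist v a`.
      gate : ∀ {e y} → dist e y ≡ dist p q → dist v a + dist a e ≤ dist v e
      gate {e} {y} ey≡D with farther-end e y
      ... | inj₁ le = via-end (≤-antisym (diametral e p) (subst (_≤ dist e p) ey≡D le))
                              (via refl (trans (sym a-between) (cong (_+ dist a q) (dist-sym p a))))
      ... | inj₂ le = via-end (≤-antisym (diametral e q) (subst (_≤ dist e q) ey≡D le))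
                              (via (dist-sym q p) (trans (dist-sym q p)
                                (trans (sym a-between)
                                  (trans (+-comm (dist p a) _) (cong (dist a q +_) (dist-sym p a))))))

-- Finite subsets and counting.

module _ {n : ℕ} where

  x∈p⇒p∪⁅x⁆≡p : ∀ {x} {p : Subset n} → x ∈ₛ p → p ∪ ⁅ x ⁆ ≡ p
  x∈p⇒p∪⁅x⁆≡p {x} {p} x∈p = ⊆-antisym
    (λ y∈ → Sum.[ id , (λ y∈x → subst (_∈ₛ p) (sym (x∈⁅y⁆⇒x≡y x y∈x)) x∈p) ]′ (x∈p∪q⁻ p ⁅ x ⁆ y∈))
    (p⊆p∪q ⁅ x ⁆)

  x∈p∪⁅x⁆ : ∀ {x} {p : Subset n} → x ∈ₛ p ∪ ⁅ x ⁆
  x∈p∪⁅x⁆ {x} = x∈p∪q⁺ (inj₂ (x∈⁅x⁆ x))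

  ∈-insert⁻ : ∀ {x y} {p : Subset n} → y ∈ₛ p ∪ ⁅ x ⁆ → y ∈ₛ p ⊎ y ≡ x
  ∈-insert⁻ {x} {p = p} = Sum.map₂ (x∈⁅y⁆⇒x≡y x) ∘ x∈p∪q⁻ p ⁅ x ⁆

  separate : ∀ {P : Fin n → Set} → Decidable P → Subset n
  separate P? = tabulate (does ∘ P?)

  ∈-separate⁺ : ∀ {P : Fin n → Set} (P? : Decidable P) {x} → P x → x ∈ₛ separate P?
  ∈-separate⁺ P? {x} px = lookup⇒[]= x _ (trans (lookup∘tabulate (does ∘ P?) x) (dec-true (P? x) px))

  ∈-separate⁻ : ∀ {P : Fin n → Set} (P? : Decidable P) {x} → x ∈ₛ separate P? → P x
  ∈-separate⁻ P? {x} x∈ =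
    invert (subst (Reflects _) (trans (sym (lookup∘tabulate (does ∘ P?) x)) ([]=⇒lookup x∈)) (proof (P? x)))

∣p∪⁅x⁆∣≤1+∣p∣ : ∀ {n} (p : Subset n) x → ∣ p ∪ ⁅ x ⁆ ∣ ≤ suc ∣ p ∣
∣p∪⁅x⁆∣≤1+∣p∣ (inside  ∷ p) Fin.zero    = s≤s (≤-trans (≤-reflexive (cong ∣_∣ (∪-identityʳ p))) (n≤1+n _))
∣p∪⁅x⁆∣≤1+∣p∣ (outside ∷ p) Fin.zero    = s≤s (≤-reflexive (cong ∣_∣ (∪-identityʳ p)))
∣p∪⁅x⁆∣≤1+∣p∣ (inside  ∷ p) (Fin.suc x) = s≤s (∣p∪⁅x⁆∣≤1+∣p∣ p x)
∣p∪⁅x⁆∣≤1+∣p∣ (outside ∷ p) (Fin.suc x) = ∣p∪⁅x⁆∣≤1+∣p∣ p x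

module _ {n : ℕ} where

  x∉p⇒∣p∪⁅x⁆∣≡1+∣p∣ : ∀ {x} {p : Subset n} → x ∉ₛ p → ∣ p ∪ ⁅ x ⁆ ∣ ≡ suc ∣ p ∣
  x∉p⇒∣p∪⁅x⁆∣≡1+∣p∣ {x} {p} x∉p =
    ≤-antisym (∣p∪⁅x⁆∣≤1+∣p∣ p x) (p⊂q⇒∣p∣<∣q∣ (p⊆p∪q ⁅ x ⁆ , x , x∈p∪⁅x⁆ , x∉p))

  fromElements : List (Fin n) → Subset n
  fromElements = foldr (λ x p → p ∪ ⁅ x ⁆) ⊥

  ∈-fromElements⁺ : ∀ {x xs} → x ∈ xs → x ∈ₛ fromElements xs
  ∈-fromElements⁺ (here refl) = x∈p∪⁅x⁆
  ∈-fromElements⁺ (there x∈)  = x∈p∪q⁺ (inj₁ (∈-fromElements⁺ x∈))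

  ∈-fromElements⁻ : ∀ {x} xs → x ∈ₛ fromElements xs → x ∈ xs
  ∈-fromElements⁻ []       x∈ = contradiction x∈ ∉⊥
  ∈-fromElements⁻ (y ∷ xs) x∈ = Sum.[ there ∘ ∈-fromElements⁻ xs , here ]′ (∈-insert⁻ x∈)

  ∣fromElements∣≤length : ∀ xs → ∣ fromElements xs ∣ ≤ length xs
  ∣fromElements∣≤length []       = ≤-reflexive (∣⊥∣≡0 n)
  ∣fromElements∣≤length (x ∷ xs) =
    ≤-trans (∣p∪⁅x⁆∣≤1+∣p∣ (fromElements xs) x) (s≤s (∣fromElements∣≤length xs))

  -- The representatives are moved into `Q` one by one, highest label first. A vertex bears at most
  -- one label, so those still to be moved stay outside `Q`.
  count-representatives : ∀ {R : ℕ → Fin n → Set} → (∀ {i j s} → R i s → R j s → i ≡ j) →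
                          ∀ m {S Q : Subset n} → Q ⊆ S →
                          (∀ j → j < m → ∃ λ s → s ∈ₛ S × s ∉ₛ Q × R j s) → m + ∣ Q ∣ ≤ ∣ S ∣
  count-representatives R-unique zero    Q⊆S _ = p⊆q⇒∣p∣≤∣q∣ Q⊆S
  count-representatives {R} R-unique (suc m) {S} {Q} Q⊆S reps with reps m ≤-refl
  ... | s , s∈S , s∉Q , Rms = begin
    suc m + ∣ Q ∣        ≡⟨ +-suc m _ ⟨
    m + suc ∣ Q ∣        ≡⟨ cong (m +_) (x∉p⇒∣p∪⁅x⁆∣≡1+∣p∣ s∉Q) ⟨
    m + ∣ Q ∪ ⁅ s ⁆ ∣    ≤⟨ count-representatives R-unique m Qs⊆S reps′ ⟩
    ∣ S ∣                ∎
    where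
    open ≤-Reasoning
    Qs⊆S : Q ∪ ⁅ s ⁆ ⊆ S
    Qs⊆S x∈ with ∈-insert⁻ x∈
    ... | inj₁ x∈Q  = Q⊆S x∈Q
    ... | inj₂ refl = s∈S
    reps′ : ∀ j → j < m → ∃ λ t → t ∈ₛ S × t ∉ₛ Q ∪ ⁅ s ⁆ × R j t
    reps′ j j<m with reps j (m≤n⇒m≤1+n j<m)
    ... | t , t∈S , t∉Q , Rjt = t , t∈S , t∉Qs , Rjt
      where
      t∉Qs : t ∉ₛ Q ∪ ⁅ s ⁆
      t∉Qs t∈ with ∈-insert⁻ t∈
      ... | inj₁ t∈Q  = t∉Q t∈Q
      ... | inj₂ refl = <⇒≢ j<m (R-unique Rjt Rms)

-- Confining the token, and discrete intermediate values along walks.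

module Game {n : ℕ} (G : Graph n) (tree : IsTree G) where
  open Graph G renaming (sym to adj-sym)
  open Walks G
  open Trees G tree

  -- By induction on the strategy tree: the Director follows the branch of a reply inside `T`.
  confined : ∀ {T : Subset n} →
             (∀ {u w d} → u ∈ₛ T → IsDist G u w d → ∃ λ w′ → w′ ∈ₛ T × IsDist G u w′ d) →
             ∀ {k S u} → ExplorerForces G k S u → u ∈ₛ T → S ⊆ T → k ≤ ∣ T ∣
  confined closed (stop k≤) u∈T S⊆T = ≤-trans k≤ (p⊆q⇒∣p∣≤∣q∣ S⊆T)
  confined {T} closed (name {S} d (w , uw) respond) u∈T S⊆T with closed u∈T uw
  ... | w′ , w′∈T , uw′ = confined closed (respond w′ uw′) w′∈T S∪w′⊆T
    where
    S∪w′⊆T : S ∪ ⁅ w′ ⁆ ⊆ T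
    S∪w′⊆T x∈ with ∈-insert⁻ x∈
    ... | inj₁ x∈S  = S⊆T x∈S
    ... | inj₂ refl = w′∈T

  module _ (f : Fin n → ℕ) (lipschitz : ∀ {u w} → Adj u w → f u ≤ suc (f w)) where

    -- A discrete intermediate value theorem: along an edge `f` changes by at most one, so no value
    -- is skipped. The next two lemmas apply it between a vertex of the walk and the start or the
    -- end of the walk.
    ascend : ∀ {u xs v i} → NonBacktracking u xs v → f u ≤ i → i ≤ f v →
             ∃ λ w → w ∈ u ∷ xs × f w ≡ i
    ascend nil fu≤i i≤fu = _ , here refl , ≤-antisym fu≤i i≤fu
    ascend {u} {i = i} (cons a p _) fu≤i i≤fv with f u ≟ i
    ... | yes fu≡i = u , here refl , fu≡i
    ... | no  fu≢i =
      let w , w∈ , fw = ascend p (≤-trans (lipschitz (adj-sym a)) (≤∧≢⇒< fu≤i fu≢i)) i≤fv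
      in  w , there w∈ , fw

    descend : ∀ {u xs v a i} → NonBacktracking u xs v → a ∈ u ∷ xs → f a ≤ i → i ≤ f u →
              ∃ λ w → w ∈ u ∷ xs × f w ≡ i
    descend p (here refl) fa≤i i≤fu = _ , here refl , ≤-antisym fa≤i i≤fu
    descend {u} {i = i} (cons e p _) (there a∈) fa≤i i≤fu with f u ≟ i
    ... | yes fu≡i = u , here refl , fu≡i
    ... | no  fu≢i =
      let w , w∈ , fw = descend p a∈ fa≤i (s≤s⁻¹ (≤-trans (≤∧≢⇒< i≤fu (fu≢i ∘ sym)) (lipschitz e)))
      in  w , there w∈ , fw

    reach-end : ∀ {u xs v a i} → NonBacktracking u xs v → a ∈ u ∷ xs → f a ≤ i → i ≤ f v →
                ∃ λ w → w ∈ u ∷ xs × f w ≡ i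
    reach-end p            (here refl) fa≤i i≤fv = ascend p fa≤i i≤fv
    reach-end (cons _ p _) (there a∈)  fa≤i i≤fv =
      let w , w∈ , fw = reach-end p a∈ fa≤i i≤fv in w , there w∈ , fw

  dist-lipschitz : ∀ o {u w} → Adj u w → dist o u ≤ suc (dist o w)
  dist-lipschitz o {u} {w} a = begin
    dist o u               ≤⟨ dist-triangle o w u ⟩
    dist o w + dist w u    ≡⟨ cong (dist o w +_) (dist-adj (adj-sym a)) ⟩
    dist o w + 1           ≡⟨ +-comm (dist o w) 1 ⟩
    suc (dist o w)         ∎
    where open ≤-Reasoning

  -- The Director's bound.

  module _ {p q xs} (P : NonBacktracking p xs q) (diametral : ∀ x y → dist x y ≤ dist p q) where

    upper-bound : ∀ {a v k} → a ∈ p ∷ xs → ExplorerForces G k ⁅ v ⁆ v → k ≤ suc (dist p q + dist a v)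
    upper-bound {a} {v} {k} a∈P forces = begin
      k                                    ≤⟨ confined closed forces v∈T v⊆T ⟩
      ∣ fromElements L ∣                   ≤⟨ ∣fromElements∣≤length L ⟩
      length L                             ≡⟨ length-++ (p ∷ xs) ⟩
      suc (length xs + length (route a v)) ≡⟨ cong suc (cong₂ _+_ (length≡dist P) (length-route a v)) ⟩
      suc (dist p q + dist a v)            ∎
      where
      open ≤-Reasoning
      L : List (Fin n)
      -- `route a v` omits its start `a`, already on the path, so `a` is not counted twice.
      L = (p ∷ xs) ++ route a v

      tail⊆L : ∀ {x} → x ∈ a ∷ route a v → x ∈ L
      tail⊆L (here refl) = ∈-++⁺ˡ a∈P
      tail⊆L (there x∈)  = ∈-++⁺ʳ (p ∷ xs) x∈

      v∈T : v ∈ₛ fromElements L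
      v∈T = ∈-fromElements⁺ (tail⊆L (end∈ (route-walk a v)))

      v⊆T : ⁅ v ⁆ ⊆ fromElements L
      v⊆T x∈ = subst (_∈ₛ fromElements L) (sym (x∈⁅y⁆⇒x≡y v x∈)) v∈T

      on-P : ∀ {o b i} → b ∈ p ∷ xs → dist o b ≤ i → i ≤ dist o p ⊎ i ≤ dist o q →
             ∃ λ w → w ∈ L × dist o w ≡ i
      on-P {o} b∈ ob≤i far =
        let w , w∈ , ow = Sum.[ descend (dist o) (dist-lipschitz o) P b∈ ob≤i
                              , reach-end (dist o) (dist-lipschitz o) P b∈ ob≤i ]′ far
        in  w , ∈-++⁺ˡ w∈ , ow

      on-L : ∀ {u i} → u ∈ L → i ≤ dist u p ⊎ i ≤ dist u q → ∃ λ w → w ∈ L × dist u w ≡ i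
      -- From a vertex on the path, search the path from that vertex on. From the tail, search
      -- between the token and `a` for distances up to `dist u a`, and on the path starting at `a`
      -- for larger ones.
      on-L {u} {i} u∈ far with ∈-++⁻ (p ∷ xs) u∈ | i ≤? dist u a
      ... | inj₁ u∈P | _          = on-P u∈P (subst (_≤ i) (sym (dist-refl u)) z≤n) far
      ... | inj₂ _   | no  i≰ua   = on-P a∈P (≰⇒≥ i≰ua) far
      ... | inj₂ u∈t | yes i≤ua   =
        let w , w∈ , uw = descend (dist u) (dist-lipschitz u) (route-walk a v) (there u∈t)
                            (subst (_≤ i) (sym (dist-refl u)) z≤n) i≤ua
        in  w , tail⊆L w∈ , uw

      closed : ∀ {u w d} → u ∈ₛ fromElements L → IsDist G u w d →
               ∃ λ w′ → w′ ∈ₛ fromElements L × IsDist G u w′ d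
      closed {u} {w} u∈ uw with IsDist⇒dist uw
      ... | refl =
        let w′ , w′∈ , eq = on-L (∈-fromElements⁻ L u∈) (farther-end diametral u w)
        in  w′ , ∈-fromElements⁺ w′∈ , dist⇒IsDist eq

  -- The Explorer's probing move, and ends of diametral paths.

  Hit : Subset n → Fin n → ℕ → Set
  Hit A u j = ∃ λ s → s ∈ₛ A × dist u s ≡ j

  hit? : ∀ A u → Decidable (Hit A u)
  hit? A u j = Fin.any? λ s → (s ∈? A) ×-dec (dist u s ≟ j)

  -- Naming a distance that no vertex of `A` realises forces a reply outside `A`, from which `unhit`
  -- continues. If there is no such distance below `m`, no move is made and `all-hit` takes over.
  probe : ∀ {k S u} A m → (∀ j → j < m → ∃ λ w → dist u w ≡ j) →
          (∀ w → w ∉ₛ A → dist u w < m → ExplorerForces G k (S ∪ ⁅ w ⁆) w) →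
          ((∀ j → j < m → Hit A u j) → ExplorerForces G k S u) →
          ExplorerForces G k S u
  probe {u = u} A m nameable unhit all-hit with anyUpTo? (¬? ∘ hit? A u) m
  ... | no  none =
    all-hit λ j j<m → decidable-stable (hit? A u j) λ ¬hit → none (j , j<m , ¬hit)
  ... | yes (j , j<m , ¬hit) =
    name j (let w , uw = nameable j j<m in w , dist⇒IsDist uw) λ w uw →
      unhit w (λ w∈A → ¬hit (w , w∈A , IsDist⇒dist uw)) (subst (_< m) (sym (IsDist⇒dist uw)) j<m)

  module _ {p q} (diametral : ∀ x y → dist x y ≤ dist p q) where
    open ≤-Reasoning hiding (stop)

    D : ℕ
    D = dist p q

    End : Fin n → Set
    End e = ∃ λ y → dist e y ≡ D

    end? : Decidable End
    end? e = Fin.any? λ y → dist e y ≟ D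

    farthest : ∀ x → ∃ λ e → ∀ y → dist x y ≤ dist x e
    farthest x = argmax (dist x) p (allFin n) ,
      λ y → All.lookup (f[xs]≤f[argmax] p (allFin n)) (∈-allFin y)

    distances-from-end : ∀ {e} → End e → ∀ j → j < suc D → ∃ λ w → dist e w ≡ j
    distances-from-end {e} (y , ey) j j≤D =
      let w , _ , ew = geodesic e y (≤-trans (s≤s⁻¹ j≤D) (≤-reflexive (sym ey))) in w , ew

    -- Visiting a further D + 1 vertices beside a set `Q` visited earlier.

    module _ {a} (Q : Subset n) (outside-Q : ∀ {x e} → x ∈ₛ Q → End e → dist a e < dist x e) where

      -- The vertices counted are at distance j ≤ dist a e′ from e′ or at distance
      -- D − j from e with j > dist a e′: there is no overlap because e and e′ are at
      -- distance D, and no such vertex is in Q because Q is farther from both than a.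
      hits-from-both-ends : ∀ {e e′ S} → dist e e′ ≡ D → Q ⊆ S →
        (∀ j → j < suc D → Hit S e j) → (∀ j → j < suc D → Hit S e′ j) → suc D + ∣ Q ∣ ≤ ∣ S ∣
      hits-from-both-ends {e} {e′} {S} ee′ Q⊆S hits hits′ =
        count-representatives R-unique (suc D) Q⊆S representative
        where
        R : ℕ → Fin n → Set
        R j s = (dist e′ s ≡ j × j ≤ dist a e′) ⊎ (dist e s + j ≡ D × dist a e′ < j)

        no-overlap : ∀ {i j s} → dist e′ s ≡ i → i ≤ dist a e′ → dist e s + j ≡ D → ¬ dist a e′ < j
        no-overlap {i} {j} {s} e′s i≤ es+j <j = <-irrefl refl (begin-strict
          D                        ≡⟨ ee′ ⟨
          dist e e′                ≤⟨ dist-triangle e s e′ ⟩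
          dist e s + dist s e′     ≡⟨ cong (dist e s +_) (trans (dist-sym s e′) e′s) ⟩
          dist e s + i             <⟨ +-monoʳ-< (dist e s) (≤-<-trans i≤ <j) ⟩
          dist e s + j             ≡⟨ es+j ⟩
          D                        ∎)

        R-unique : ∀ {i j s} → R i s → R j s → i ≡ j
        R-unique (inj₁ (e′s , _)) (inj₁ (e′s′ , _)) = trans (sym e′s) e′s′
        R-unique (inj₁ (e′s , i≤)) (inj₂ (es+j , <j)) = contradiction <j (no-overlap e′s i≤ es+j)
        R-unique (inj₂ (es+j , <j)) (inj₁ (e′s , i≤)) = contradiction <j (no-overlap e′s i≤ es+j)
        R-unique {s = s} (inj₂ (es+i , _)) (inj₂ (es+j , _)) = +-cancelˡ-≡ (dist e s) _ _ (trans es+i (sym es+j))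

        representative : ∀ j → j < suc D → ∃ λ s → s ∈ₛ S × s ∉ₛ Q × R j s
        representative j j<1+D with j ≤? dist a e′
        ... | yes j≤ with hits′ j j<1+D
        ...   | s , s∈S , e′s = s , s∈S , s∉Q , inj₁ (e′s , j≤)
          where
          s∉Q : s ∉ₛ Q
          s∉Q s∈Q = <⇒≱ (outside-Q s∈Q (e , trans (dist-sym e′ e) ee′))
                        (≤-trans (≤-reflexive (trans (dist-sym s e′) e′s)) j≤)
        representative j j<1+D | no j≰ with hits (D ∸ j) (s≤s (m∸n≤m D j))
        ...   | s , s∈S , es = s , s∈S , s∉Q , inj₂ (es+j , ≰⇒> j≰)
          where
          es+j : dist e s + j ≡ D
          es+j = trans (cong (_+ j) es) (m∸n+n≡m (s≤s⁻¹ j<1+D))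
          s∉Q : s ∉ₛ Q
          s∉Q s∈Q = <-irrefl refl (begin-strict
            D                        ≡⟨ ee′ ⟨
            dist e e′                ≤⟨ dist-triangle e a e′ ⟩
            dist e a + dist a e′     <⟨ +-mono-< (subst₂ _<_ (dist-sym a e) (dist-sym s e) (outside-Q s∈Q (e′ , ee′)))
                                                (≰⇒> j≰) ⟩
            dist e s + j             ≡⟨ es+j ⟩
            D                        ∎)

      -- `f` bounds the number of vertices still missing. Each round either visits a new vertex and
      -- lowers `f`, or finds all distances realised at two opposite ends, where
      -- `hits-from-both-ends` gives enough vertices.
      force-remaining : ∀ {k} → k ≤ suc D + ∣ Q ∣ → ∀ f {S x} → Q ⊆ S → k ≤ f + ∣ S ∣ → ExplorerForces G k S x
      force-remaining k≤ zero Q⊆S k≤S = stop k≤S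
      force-remaining {k} k≤ (suc f) {S} {x} Q⊆S k≤S with farthest x
      -- Any reply `e₁` is as far from `x` as `e` is, hence farthest from `x` and an end.
      ... | e , x-e-farthest = name (dist x e) (e , dist-IsDist x e) λ e₁ xe₁ →
        from-end (farthest⇒end diametral λ y → ≤-trans (x-e-farthest y) (≤-reflexive (sym (IsDist⇒dist xe₁))))
                 (grow-⊆ Q⊆S) (≤-trans k≤S (+-monoʳ-≤ (suc f) (∣p∣≤∣p∪q∣ S ⁅ e₁ ⁆)))
        where
        grow-⊆ : ∀ {S w} → Q ⊆ S → Q ⊆ S ∪ ⁅ w ⁆
        grow-⊆ {w = w} Q⊆S x∈ = p⊆p∪q ⁅ w ⁆ (Q⊆S x∈)

        new-vertex : ∀ {S} → Q ⊆ S → k ≤ suc f + ∣ S ∣ → ∀ w → w ∉ₛ S → ExplorerForces G k (S ∪ ⁅ w ⁆) w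
        new-vertex {S} Q⊆S k≤S w w∉S = force-remaining k≤ f (grow-⊆ Q⊆S) (begin
          k                       ≤⟨ k≤S ⟩
          suc f + ∣ S ∣           ≡⟨ +-suc f _ ⟨
          f + suc ∣ S ∣           ≡⟨ cong (f +_) (x∉p⇒∣p∪⁅x⁆∣≡1+∣p∣ w∉S) ⟨
          f + ∣ S ∪ ⁅ w ⁆ ∣       ∎)

        from-end : ∀ {S e} → End e → Q ⊆ S → k ≤ suc f + ∣ S ∣ → ExplorerForces G k S e
        from-end {S} {e} end@(y , ey) Q⊆S k≤S =
          probe S (suc D) (distances-from-end end) (λ w w∉S _ → new-vertex Q⊆S k≤S w w∉S) λ hits →
          name D (y , dist⇒IsDist ey) λ e′ ee′ →
          probe (S ∪ ⁅ e′ ⁆) (suc D)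
                (distances-from-end (e , trans (dist-sym e′ e) (IsDist⇒dist ee′)))
                (λ w w∉ _ → new-vertex (grow-⊆ Q⊆S)
                  (≤-trans k≤S (+-monoʳ-≤ (suc f) (∣p∣≤∣p∪q∣ S ⁅ e′ ⁆))) w w∉) λ hits′ →
          stop (≤-trans k≤ (hits-from-both-ends (IsDist⇒dist ee′) (grow-⊆ Q⊆S)
            (λ j j<1+D → let s , s∈S , es = hits j j<1+D in s , p⊆p∪q ⁅ e′ ⁆ s∈S , es) hits′))

    -- Visiting l vertices of positive height.

    module _ (a : Fin n) where

      -- Truncated subtraction makes the height 0 as soon as some end is no farther
      -- from x than from a.
      height : Fin n → ℕ
      height x = excess (argmin excess p (filter end? (allFin n)))
        where
        excess : Fin n → ℕ
        excess e = dist x e ∸ dist a e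

      height-≤ : ∀ x {e} → End e → height x ≤ dist x e ∸ dist a e
      height-≤ x {e} end =
        All.lookup (f[argmin]≤f[xs] p (filter end? (allFin n))) (∈-filter⁺ end? (∈-allFin e) end)

      height-greatest : ∀ x {t} → (∀ {e} → End e → t ≤ dist x e ∸ dist a e) → t ≤ height x
      -- The default `p` of `argmin` must be covered too; it is an end, opposite to `q`.
      height-greatest x t≤ = v≤f[argmin]⁺ (t≤ (q , refl)) (All.map t≤ (all-filter end? (allFin n)))

      height-≤-dist : ∀ x → height x ≤ dist x p
      height-≤-dist x = ≤-trans (height-≤ x (q , refl)) (m∸n≤m _ (dist a p))

      height-lipschitz : ∀ x w → height x ≤ height w + dist x w
      height-lipschitz x w = subst (height x ≤_) (+-comm (dist x w) (height w))
        (m∸n≤o⇒m≤n+o (height x) (dist x w) (height-greatest w λ {e} end → begin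
          height x ∸ dist x w                  ≤⟨ ∸-monoˡ-≤ (dist x w) (height-≤ x end) ⟩
          dist x e ∸ dist a e ∸ dist x w       ≡⟨ ∸-+-assoc (dist x e) (dist a e) (dist x w) ⟩
          dist x e ∸ (dist a e + dist x w)     ≡⟨ cong (dist x e ∸_) (+-comm (dist a e) _) ⟩
          dist x e ∸ (dist x w + dist a e)     ≡⟨ ∸-+-assoc (dist x e) (dist x w) (dist a e) ⟨
          dist x e ∸ dist x w ∸ dist a e       ≤⟨ ∸-monoˡ-≤ (dist a e)
                                                    (m≤n+o⇒m∸n≤o _ (dist x w) (dist-triangle x w e)) ⟩
          dist w e ∸ dist a e                  ∎))
        where
        m∸n≤o⇒m≤n+o : ∀ m n {o} → m ∸ n ≤ o → m ≤ n + o
        m∸n≤o⇒m≤n+o m n m∸n≤o = ≤-trans (m≤n+m∸n m n) (+-monoʳ-≤ n m∸n≤o)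

      above : ℕ → Subset n
      above t = separate λ x → t <? height x

      below : ℕ → Subset n
      below t = separate λ x → height x ≤? t

      module _ (l : ℕ) where

        -- `g` vertices are still to be collected. By `many`, the visited vertices sorted by
        -- decreasing height have heights at least l, l - 1, ..., g + 1.
        record Climbing (g : ℕ) (S : Subset n) : Set where
          field
            size : ∣ S ∣ + g ≡ l
            high : ∀ {y} → y ∈ₛ S → g < height y
            many : ∀ {t} → g ≤ t → l ≤ t + ∣ S ∩ above t ∣

        open Climbing

        -- In `many` only the threshold `g` is new, and every vertex of the enlarged set lies above
        -- it.
        climbing-insert : ∀ {g S w} → Climbing (suc g) S → w ∉ₛ S → g < height w → Climbing g (S ∪ ⁅ w ⁆)
        climbing-insert {g} {S} {w} c w∉S g<hw = record { size = size′ ; high = high′ ; many = many′ }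
          where
          size′ : ∣ S ∪ ⁅ w ⁆ ∣ + g ≡ l
          size′ = trans (cong (_+ g) (x∉p⇒∣p∪⁅x⁆∣≡1+∣p∣ w∉S)) (trans (sym (+-suc ∣ S ∣ g)) (size c))

          high′ : ∀ {y} → y ∈ₛ S ∪ ⁅ w ⁆ → g < height y
          high′ y∈ with ∈-insert⁻ y∈
          ... | inj₁ y∈S  = <-trans (n<1+n g) (high c y∈S)
          ... | inj₂ refl = g<hw

          many′ : ∀ {t} → g ≤ t → l ≤ t + ∣ (S ∪ ⁅ w ⁆) ∩ above t ∣
          many′ {t} g≤t with m≤n⇒m<n∨m≡n g≤t
          ... | inj₁ g<t = ≤-trans (many c g<t) (+-monoʳ-≤ t (p⊆q⇒∣p∣≤∣q∣ λ x∈ →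
            let x∈S , x∈above = x∈p∩q⁻ S (above t) x∈ in x∈p∩q⁺ (p⊆p∪q ⁅ w ⁆ x∈S , x∈above)))
          ... | inj₂ refl = begin
            l                                  ≡⟨ size′ ⟨
            ∣ S ∪ ⁅ w ⁆ ∣ + g                  ≡⟨ +-comm _ g ⟩
            g + ∣ S ∪ ⁅ w ⁆ ∣                  ≤⟨ +-monoʳ-≤ g (p⊆q⇒∣p∣≤∣q∣ all-above) ⟩
            g + ∣ (S ∪ ⁅ w ⁆) ∩ above g ∣      ∎
            where
            all-above : S ∪ ⁅ w ⁆ ⊆ (S ∪ ⁅ w ⁆) ∩ above g
            all-above x∈ = x∈p∩q⁺ (x∈ , ∈-separate⁺ (λ y → g <? height y) (high′ x∈))

        -- By many, too few visited vertices have height at most height x to realise all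
        -- of these distances.
        some-class-unhit : ∀ {g S x} → Climbing (suc g) S → x ∈ₛ S →
                           ¬ (∀ j → j < height x ∸ g → Hit (S ∩ below (height x)) x j)
        some-class-unhit {g} {S} {x} c x∈S hits = <-irrefl refl (begin-strict
          h + ∣ S ∩ above h ∣              ≡⟨ cong (_+ ∣ S ∩ above h ∣) (m+[n∸m]≡n g≤h) ⟨
          g + (h ∸ g) + ∣ S ∩ above h ∣    ≡⟨ +-assoc g _ _ ⟩
          g + (h ∸ g + ∣ S ∩ above h ∣)    ≤⟨ +-monoʳ-≤ g (count-representatives (λ {_} {_} {s} → R-unique s) (h ∸ g)
                                                  (p∩q⊆p S (above h)) representative) ⟩
          g + ∣ S ∣                        ≡⟨ +-comm g _ ⟩
          ∣ S ∣ + g                        <⟨ +-monoʳ-< ∣ S ∣ (n<1+n g) ⟩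
          ∣ S ∣ + suc g                    ≡⟨ size c ⟩
          l                                ≤⟨ many c (<⇒≤ (high c x∈S)) ⟩
          h + ∣ S ∩ above h ∣              ∎)
          where
          h : ℕ
          h = height x
          g≤h : g ≤ h
          g≤h = ≤-trans (n≤1+n g) (<⇒≤ (high c x∈S))
          R-unique : ∀ s {i j} → dist x s ≡ i → dist x s ≡ j → i ≡ j
          R-unique s xs≡i xs≡j = trans (sym xs≡i) xs≡j
          representative : ∀ j → j < h ∸ g → ∃ λ s → s ∈ₛ S × s ∉ₛ S ∩ above h × dist x s ≡ j
          representative j j< =
            let s , s∈ , xs = hits j j<
                s∈S , s∈below = x∈p∩q⁻ S (below h) s∈
            in  s , s∈S ,
                (λ s∈above → ≤⇒≯ (∈-separate⁻ (λ y → height y ≤? h) s∈below)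
                  (∈-separate⁻ (λ y → h <? height y) (proj₂ (x∈p∩q⁻ S (above h) s∈above)))) , xs

        Target : ℕ
        Target = suc D + l

        -- The Explorer names a distance below `height x ∸ g` realised by no visited vertex of
        -- height at most `height x`. The reply is either a visited vertex of larger height, or a
        -- new one, whose height still exceeds `g` by the Lipschitz bound.
        climb-step : ∀ {g S x} → Climbing (suc g) S → x ∈ₛ S →
          (∀ {w} → w ∈ₛ S → height x < height w → ExplorerForces G Target S w) →
          (∀ {S w} → Climbing g S → w ∈ₛ S → ExplorerForces G Target S w) →
          ExplorerForces G Target S x
        climb-step {g} {S} {x} c x∈S higher next =
          probe (S ∩ below h) (h ∸ g)
            (λ j j< →
              let w , _ , xw = geodesic x p (≤-trans (<⇒≤ j<) (≤-trans (m∸n≤m h g) (height-≤-dist x)))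
              in  w , xw)
            reply
            (λ hits → contradiction hits (some-class-unhit c x∈S))
          where
          h : ℕ
          h = height x

          reply : ∀ w → w ∉ₛ S ∩ below h → dist x w < h ∸ g → ExplorerForces G Target (S ∪ ⁅ w ⁆) w
          reply w w∉ xw< with w ∈? S
          ... | yes w∈S = subst (λ T → ExplorerForces G Target T w) (sym (x∈p⇒p∪⁅x⁆≡p w∈S))
            (higher w∈S (≰⇒> λ hw≤h → w∉ (x∈p∩q⁺ (w∈S , ∈-separate⁺ (λ y → height y ≤? h) hw≤h))))
          ... | no  w∉S = next (climbing-insert c w∉S g<hw) x∈p∪⁅x⁆
            where
            g<hw : g < height w
            g<hw = +-cancelʳ-< (dist x w) _ _ (begin-strict
              g + dist x w         <⟨ +-monoʳ-< g xw< ⟩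
              g + (h ∸ g)          ≡⟨ m+[n∸m]≡n (≤-trans (n≤1+n g) (<⇒≤ (high c x∈S))) ⟩
              h                    ≤⟨ height-lipschitz x w ⟩
              height w + dist x w  ∎)

        -- b bounds how often the reply can be an already visited higher vertex.
        climb : ∀ g b {S x} → Climbing g S → x ∈ₛ S → D ≤ b + height x → ExplorerForces G Target S x
        -- All l vertices are collected. Positive height means being farther than `a` from every
        -- end, so `S` can serve as `Q`; at most D + 1 vertices are missing.
        climb zero _ {S} c _ _ = force-remaining S outside-S Target≤ (suc D) id Target≤
          where
          outside-S : ∀ {x e} → x ∈ₛ S → End e → dist a e < dist x e
          outside-S {x} {e} x∈S end = m∸n≢0⇒n<m λ eq →
            <⇒≱ (high c x∈S) (≤-trans (height-≤ x end) (≤-reflexive eq))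
          Target≤ : Target ≤ suc D + ∣ S ∣
          Target≤ = +-monoʳ-≤ (suc D) (≤-reflexive (trans (sym (size c)) (+-identityʳ _)))
        -- Here `x` has height at least D, and no height exceeds D, so a higher reply is impossible.
        -- After a new vertex `g` drops and the bound restarts at D.
        climb (suc g) zero c x∈S D≤ = climb-step c x∈S
          (λ {w} _ h<hw → contradiction (≤-trans (height-≤-dist w) (diametral w p)) (<⇒≱ (≤-<-trans D≤ h<hw)))
          (λ c′ w∈ → climb g D c′ w∈ (m≤m+n D _))
        climb (suc g) (suc b) {x = x} c x∈S D≤ = climb-step c x∈S
          (λ w∈S h<hw → climb (suc g) b c w∈S
            (≤-trans D≤ (≤-trans (≤-reflexive (sym (+-suc b (height x)))) (+-monoʳ-≤ b h<hw))))
          (λ c′ w∈ → climb g D c′ w∈ (m≤m+n D _))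

      lower-bound : ∀ l v → (∀ {e} → End e → l + dist a e ≤ dist v e) → ExplorerForces G (suc D + l) ⁅ v ⁆ v
      -- Nothing has to be collected first, so `Q` is empty.
      lower-bound zero v _ =
        force-remaining {a} ⊥ (λ x∈ → contradiction x∈ ∉⊥) (+-monoʳ-≤ (suc D) z≤n)
          (suc D) (λ x∈ → contradiction x∈ ∉⊥) (+-monoʳ-≤ (suc D) z≤n)
      -- The start `v` is itself the first of the vertices of positive height, which leaves `g` to
      -- collect.
      lower-bound (suc g) v far = climb (suc g) g D initial (x∈⁅x⁆ v) (m≤m+n D _)
        where
        l≤hv : suc g ≤ height v
        l≤hv = height-greatest v λ {e} end → m+n≤o⇒m≤o∸n (suc g) (far end)

        initial : Climbing (suc g) g ⁅ v ⁆
        initial = record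
          { size = cong (_+ g) (∣⁅x⁆∣≡1 v)
          ; high = high-v
          ; many = many-v
          }
          where
          high-v : ∀ {y} → y ∈ₛ ⁅ v ⁆ → g < height y
          high-v y∈ = subst (λ y → g < height y) (sym (x∈⁅y⁆⇒x≡y v y∈)) l≤hv

          many-v : ∀ {t} → g ≤ t → suc g ≤ t + ∣ ⁅ v ⁆ ∩ above t ∣
          many-v {t} g≤t with m≤n⇒m<n∨m≡n g≤t
          ... | inj₁ g<t  = ≤-trans g<t (m≤m+n t _)
          ... | inj₂ refl = begin
            suc g                      ≡⟨ +-comm 1 g ⟩
            g + 1                      ≡⟨ cong (g +_) (∣⁅x⁆∣≡1 v) ⟨
            g + ∣ ⁅ v ⁆ ∣              ≤⟨ +-monoʳ-≤ g (p⊆q⇒∣p∣≤∣q∣ all-above) ⟩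
            g + ∣ ⁅ v ⁆ ∩ above g ∣    ∎
            where
            all-above : ⁅ v ⁆ ⊆ ⁅ v ⁆ ∩ above g
            all-above x∈ = x∈p∩q⁺ (x∈ , ∈-separate⁺ (λ y → g <? height y) (high-v x∈))

  -- The value of the game.

  visited-number : ∀ {p q xs a v} → NonBacktracking p xs q → (∀ x y → dist x y ≤ dist p q) →
    a ∈ p ∷ xs → (∀ {x y m} → dist x y ≡ dist p q → m ∈ x ∷ route x y → dist v a ≤ dist v m) →
    IsVisitedNumber G v (dist p q + dist a v + 1)
  visited-number {p} {q} {xs} {a} {v} P diametral a∈P nearest =
    subst (IsVisitedNumber G v) (+-comm 1 (dist p q + dist a v))
      ( lower-bound diametral a (dist a v) v (λ { {e} (_ , ey) →
          subst (λ l → l + dist a e ≤ dist v e) (dist-sym v a) (gate diametral (between P a∈P) nearest ey) })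
      , λ k → upper-bound P diametral a∈P )

theorem3p4 : ∀ {n : ℕ} (G : Graph n) → IsTree G → (v : Fin n) →
    ∀ (D l : ℕ) → IsDiam G D → IsDistToPathsOfLength G D v l →
    IsVisitedNumber G v (D + l + 1)
theorem3p4 G tree v D l (_ , D-max) ((P , a , a∈P , av≡l) , l-min) =
  subst₂ (λ d m → IsVisitedNumber G v (d + m + 1)) pq≡D (IsDist⇒dist av≡l)
    (visited-number walk diametral (subst (a ∈_) vertices≡ (∈-toList⁺ a∈P)) nearest)
  where
  open Walks G
  open Trees G tree
  open Game G tree using (visited-number)

  p q : Fin _
  p = Path.source P
  q = Path.target P

  xs : List (Fin _)
  xs = proj₁ (fromPath P)

  walk : NonBacktracking p xs q
  walk = proj₁ (proj₂ (fromPath P))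

  vertices≡ : toList (Path.vertices P) ≡ p ∷ xs
  vertices≡ = proj₂ (proj₂ (proj₂ (fromPath P)))

  pq≡D : dist p q ≡ D
  pq≡D = trans (sym (length≡dist walk)) (proj₁ (proj₂ (proj₂ (fromPath P))))

  diametral : ∀ x y → dist x y ≤ dist p q
  diametral x y = subst (dist x y ≤_) (sym pq≡D) (D-max (dist x y) (x , y , dist-IsDist x y))

  nearest : ∀ {x y m} → dist x y ≡ dist p q → m ∈ x ∷ route x y → dist v a ≤ dist v m
  -- The route from `x` to `y` is turned into a `Path` of length `D`, to which the minimality of `l`
  -- applies.
  nearest {m = m} xy≡pq m∈ =
    let P′ , on-P′ = geodesic-path (trans xy≡pq pq≡D)
    in  subst₂ _≤_ (trans (sym (IsDist⇒dist av≡l)) (dist-sym a v)) (dist-sym m v)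
          (l-min (dist m v) (P′ , m , on-P′ m∈ , dist-IsDist m v))
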